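{- If $n$ is even, then there exists an associative magic-faced hypercube of dimension $n$ which is unique up to the symmetry group $\mathrm{Aut}(Q_n)\cong C_2^n\rtimes S_n$ of the hypercube. If $n$ is odd, then no associative magic-faced hypercube of dimension $n$ exists.
   Context: $Q_n$ is the hypercube graph on vertex set $\{0,1\}^n$ (two vertices adjacent iff they differ in exactly one coordinate); $\mathrm{Aut}(Q_n)$ is its automorphism group, acting on labelings by permuting positions. A magic-faced hypercube of dimension $n$ is an arrangement of the numbers $1,\ldots,2^n$ in a $2\times\cdots\times2$ ($n$-fold) array, each number used once, such that every $2\times2$ face has the same sum; equivalently, a bijective labeling of the vertices of $Q_n$ by $1,\ldots,2^n$ such that the labels on every $4$-cycle of $Q_n$ have the same sum. It is associative if any two numbers at positions symmetrically opposite the center of the hypercube (antipodal positions, i.e. positions differing in all $n$ coordinates) have the same sum (which must then be $2^n+1$).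
   Formalization: The non-existence claim for odd n is stated for odd n other than 1: in dimension 1 there are no 2×2 faces, so the labeling 1, 2 is vacuously magic-faced and associative, and the claim as written fails there. -}

module Defs where

open import Algebra.Bundles using (Group; module CommutativeRing)
import Algebra.Construct.Pointwise as Pointwise
open import Algebra.Morphism.Structures using (module GroupMorphisms)
open import Algebra.Properties.Group using (identityˡ-unique)
open import Data.Bool.Base using (Bool; not)
open import Data.Bool.Properties using (xor-∧-commutativeRing)
open import Data.Fin.Base using (Fin; toℕ)
import Data.Fin.Permutation as Perm
open Perm using (Permutation′; _⟨$⟩ʳ_; _⟨$⟩ˡ_; _∘ₚ_)
open import Data.Nat.Base using (ℕ; suc; _+_; _^_)
open import Data.Product using (∃; ∃!; _×_; _,_)
open import Data.Vec.Base using (Vec; lookup; _[_]%=_)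
open import Function.Bundles
  using (_⤖_; _↔_; _⇔_; module Bijection; module Inverse; module Equivalence; mk⇔)
open import Function.Construct.Composition using (_↔-∘_; _⇔-∘_)
open import Function.Construct.Identity using (↔-id; ⇔-id)
open import Function.Construct.Symmetry using (↔-sym; ⇔-sym)
open import Level using (0ℓ; _⊔_)
open import Relation.Binary.PropositionalEquality
  using (_≡_; _≢_; refl; sym; trans; cong; subst₂)

------------------------------------------------------------------------
-- Semidirect products

infix 4 _≅_

_≅_ : ∀ {a ℓ₁ b ℓ₂} → Group a ℓ₁ → Group b ℓ₂ → Set (a ⊔ ℓ₁ ⊔ b ⊔ ℓ₂)
G ≅ H = ∃ (GroupMorphisms.IsGroupIsomorphism (Group.rawGroup G) (Group.rawGroup H))

-- A left action of H on N by group automorphisms.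

record Action {a ℓ₁ b ℓ₂} (H : Group a ℓ₁) (N : Group b ℓ₂) :
              Set (a ⊔ ℓ₁ ⊔ b ⊔ ℓ₂) where
  private
    module H = Group H
    module N = Group N
  infixr 8 _·_
  field
    _·_    : H.Carrier → N.Carrier → N.Carrier
    ·-cong : ∀ {h k x y} → h H.≈ k → x N.≈ y → h · x N.≈ k · y
    ·-ε    : ∀ x → H.ε · x N.≈ x
    ·-∙    : ∀ h k x → (h H.∙ k) · x N.≈ h · k · x
    ·-homo : ∀ h x y → h · (x N.∙ y) N.≈ h · x N.∙ h · y

semidirect : ∀ {a ℓ₁ b ℓ₂} (N : Group b ℓ₂) (H : Group a ℓ₁) → Action H N →
             Group (a ⊔ b) (ℓ₁ ⊔ ℓ₂)
semidirect N H α = record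
  { Carrier = N.Carrier × H.Carrier
  ; _≈_     = λ (x , h) (y , k) → x N.≈ y × h H.≈ k
  ; _∙_     = λ (x , h) (y , k) → x N.∙ h · y , h H.∙ k
  ; ε       = N.ε , H.ε
  ; _⁻¹     = λ (x , h) → (h H.⁻¹) · (x N.⁻¹) , h H.⁻¹
  ; isGroup = record
    { isMonoid = record
      { isSemigroup = record
        { isMagma = record
          { isEquivalence = record
            { refl  = N.refl , H.refl
            ; sym   = λ (p , q) → N.sym p , H.sym q
            ; trans = λ (p , q) (r , s) → N.trans p r , H.trans q s
            }
          ; ∙-cong = λ (p , q) (r , s) → N.∙-cong p (·-cong q r) , H.∙-cong q s
          }
        ; assoc = λ (x , h) (y , k) (z , l) →
            N.trans (N.assoc _ _ _)
              (N.∙-congˡ (N.trans (N.∙-congˡ (·-∙ h k z)) (N.sym (·-homo h y (k · z)))))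
            , H.assoc h k l
        }
      ; identity =
          (λ (x , h) → N.trans (N.identityˡ _) (·-ε x) , H.identityˡ h) ,
          (λ (x , h) → N.trans (N.∙-congˡ (·-idʳ h)) (N.identityʳ x) , H.identityʳ h)
      }
    ; inverse =
        (λ (x , h) →
          N.trans (N.sym (·-homo _ _ _))
            (N.trans (·-cong H.refl (N.inverseˡ x)) (·-idʳ _))
          , H.inverseˡ h) ,
        (λ (x , h) →
          N.trans (N.∙-congˡ (N.trans (N.sym (·-∙ h (h H.⁻¹) _))
                    (N.trans (·-cong (H.inverseʳ h) N.refl) (·-ε _))))
            (N.inverseʳ x)
          , H.inverseʳ h)
    ; ⁻¹-cong = λ (p , q) → ·-cong (H.⁻¹-cong q) (N.⁻¹-cong p) , H.⁻¹-cong q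
    }
  }
  where
  module N = Group N
  module H = Group H
  open Action α

  ·-idʳ : ∀ h → h · N.ε N.≈ N.ε
  ·-idʳ h = identityˡ-unique N (h · N.ε) (h · N.ε)
    (N.trans (N.sym (·-homo h N.ε N.ε)) (·-cong H.refl (N.identityˡ N.ε)))

------------------------------------------------------------------------
-- The group C₂ⁿ ⋊ Sₙ

C₂ : Group 0ℓ 0ℓ
C₂ = CommutativeRing.+-group xor-∧-commutativeRing

C₂^_ : ℕ → Group 0ℓ 0ℓ
C₂^ n = Pointwise.group (Fin n) C₂

inverse-cong : ∀ {A : Set} (π ρ : A ↔ A) →
               (∀ x → Inverse.to π x ≡ Inverse.to ρ x) →
               ∀ x → Inverse.from π x ≡ Inverse.from ρ x
inverse-cong π ρ π≈ρ x =
  Inverse.inverseʳ π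
    (trans (sym (Inverse.strictlyInverseˡ ρ x)) (sym (π≈ρ (Inverse.from ρ x))))

-- _∘ₚ_ composes from left to right, so the product π ∘ ρ is ρ ∘ₚ π.

Sym : ℕ → Group 0ℓ 0ℓ
Sym n = record
  { Carrier = Permutation′ n
  ; _≈_     = Perm._≈_
  ; _∙_     = λ π ρ → ρ ∘ₚ π
  ; ε       = Perm.id
  ; _⁻¹     = Perm.flip
  ; isGroup = record
    { isMonoid = record
      { isSemigroup = record
        { isMagma = record
          { isEquivalence = record
            { refl  = λ _ → refl
            ; sym   = λ p i → sym (p i)
            ; trans = λ p q i → trans (p i) (q i)
            }
          ; ∙-cong = λ {π} {π′} {ρ} p q i → trans (p (ρ ⟨$⟩ʳ i)) (cong (π′ ⟨$⟩ʳ_) (q i))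
          }
        ; assoc = λ _ _ _ _ → refl
        }
      ; identity = (λ _ _ → refl) , (λ _ _ → refl)
      }
    ; inverse = (λ π _ → Perm.inverseˡ π) , (λ π _ → Perm.inverseʳ π)
    ; ⁻¹-cong = λ {π} {ρ} → inverse-cong π ρ
    }
  }

permuteCoordinates : ∀ n → Action (Sym n) (C₂^ n)
permuteCoordinates n = record
  { _·_    = λ π x i → x (π ⟨$⟩ˡ i)
  ; ·-cong = λ {π} {ρ} {x} {y} p q i →
      trans (q (π ⟨$⟩ˡ i)) (cong y (inverse-cong π ρ p i))
  ; ·-ε    = λ _ _ → refl
  ; ·-∙    = λ _ _ _ _ → refl
  ; ·-homo = λ _ _ _ _ → refl
  }

HyperoctahedralGroup : ℕ → Group 0ℓ 0ℓ
HyperoctahedralGroup n = semidirect (C₂^ n) (Sym n) (permuteCoordinates n)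

------------------------------------------------------------------------
-- The hypercube graph Qₙ

Vertex : ℕ → Set
Vertex n = Vec Bool n

Adjacent : ∀ {n} → Vertex n → Vertex n → Set
Adjacent x y = ∃! _≡_ λ i → lookup x i ≢ lookup y i

Antipodal : ∀ {n} → Vertex n → Vertex n → Set
Antipodal x y = ∀ i → lookup x i ≢ lookup y i

record Automorphism (n : ℕ) : Set where
  field
    permutation : Vertex n ↔ Vertex n

  open Inverse permutation public
    using (to; from; strictlyInverseˡ; strictlyInverseʳ)

  field
    adjacent⇔ : ∀ {x y} → Adjacent x y ⇔ Adjacent (to x) (to y)

Aut : ℕ → Group 0ℓ 0ℓ
Aut n = record
  { Carrier = Automorphism n
  ; _≈_     = λ φ ψ → ∀ x → to φ x ≡ to ψ x
  ; _∙_     = λ φ ψ → record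
      { permutation = permutation φ ↔-∘ permutation ψ
      ; adjacent⇔   = adjacent⇔ φ ⇔-∘ adjacent⇔ ψ
      }
  ; ε       = record { permutation = ↔-id _ ; adjacent⇔ = ⇔-id _ }
  ; _⁻¹     = λ φ → record
      { permutation = ↔-sym (permutation φ)
      ; adjacent⇔   = λ {x} {y} → mk⇔
          (λ a → Equivalence.from (adjacent⇔ φ)
            (subst₂ Adjacent (sym (strictlyInverseˡ φ x)) (sym (strictlyInverseˡ φ y)) a))
          (λ a → subst₂ Adjacent (strictlyInverseˡ φ x) (strictlyInverseˡ φ y)
            (Equivalence.to (adjacent⇔ φ) a))
      }
  ; isGroup = record
    { isMonoid = record
      { isSemigroup = record
        { isMagma = record
          { isEquivalence = record
            { refl  = λ _ → refl
            ; sym   = λ p x → sym (p x)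
            ; trans = λ p q x → trans (p x) (q x)
            }
          ; ∙-cong = λ {φ} {φ′} {ψ} p q x → trans (p (to ψ x)) (cong (to φ′) (q x))
          }
        ; assoc = λ _ _ _ _ → refl
        }
      ; identity = (λ _ _ → refl) , (λ _ _ → refl)
      }
    ; inverse = strictlyInverseʳ , strictlyInverseˡ
    ; ⁻¹-cong = λ {φ} {ψ} → inverse-cong (permutation φ) (permutation ψ)
    }
  }
  where open Automorphism

------------------------------------------------------------------------
-- Magic-faced hypercubes

Labeling : ℕ → Set
Labeling n = Vertex n ⤖ Fin (2 ^ n)

-- Shifts Fin (2 ^ n) so that the labels are 1, …, 2 ^ n.

label : ∀ {n} → Labeling n → Vertex n → ℕ
label f x = suc (toℕ (Bijection.to f x))

flipAt : ∀ {n} → Fin n → Vertex n → Vertex n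
flipAt i x = x [ i ]%= not

-- The sum over the 2 × 2 face through x in directions i and j.

faceSum : ∀ {n} → Labeling n → Vertex n → Fin n → Fin n → ℕ
faceSum f x i j =
  label f x + label f (flipAt i x) + label f (flipAt j x) + label f (flipAt i (flipAt j x))

-- For n ≤ 1 there are no 2 × 2 faces and this holds vacuously; in particular
-- both labelings of Q₁ are magic-faced, and also associative.

MagicFaced : ∀ {n} → Labeling n → Set
MagicFaced f = ∃ λ s → ∀ x i j → i ≢ j → faceSum f x i j ≡ s

Associative : ∀ {n} → Labeling n → Set
Associative f = ∃ λ s → ∀ x y → Antipodal x y → label f x + label f y ≡ s

AssociativeMagicFaced : ∀ {n} → Labeling n → Set
AssociativeMagicFaced f = MagicFaced f × Associative f

-- Two labelings are equivalent if they lie in the same orbit of Aut n.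

infix 4 _∼_

_∼_ : ∀ {n} → Labeling n → Labeling n → Set
_∼_ {n} f g = ∃ λ (φ : Automorphism n) →
  ∀ x → label g x ≡ label f (Automorphism.to φ x)

{-# OPTIONS --safe #-}

-- Let twist x be x or its antipode, according to the parity of x. Comparing a
-- face with the antipodal face shows that, for an associative magic-faced
-- labeling f, the function F = f ∘ twist satisfies the parallelogram law
--   F x + F (x + eᵢ + eⱼ) = F (x + eᵢ) + F (x + eⱼ),
-- so F x is a constant plus a sum of one term for each coordinate of x.
-- If n is odd, then F is invariant under the antipodal map, which forces F to be
-- constant, contradicting injectivity for n ≥ 3. If n is even, then twist is an involution
-- that commutes with the automorphisms up to the antipodal map, and F is a
-- bijection. Translating the vertex with the least label to the origin, the
-- weights of the coordinates have subset sums 0, …, 2ⁿ - 1, each once, so they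
-- are the powers of 2 in some order and F is binary expansion up to an
-- automorphism. Conversely, binary expansion composed with twist is associative
-- and magic-faced.
--
-- An automorphism of Qₙ maps edges in direction i to edges in one direction
-- that does not depend on the edge, since opposite edges of a 4-cycle remain
-- opposite; this gives the permutation, and the image of the origin the signs.

module Submission where

open import Defs
open import Algebra.Bundles using (Group)
open import Data.Bool.Base using (Bool; true; false; not; _xor_)
open import Data.Bool.Properties as Bool
  using (not-involutive; not-¬; ¬-not; xor-same; xor-assoc; xor-comm; xor-identityʳ)
open import Data.Fin.Base using (Fin; zero; suc; toℕ; fromℕ<; opposite; combine)
open import Data.Fin.Permutation as Perm using (Permutation′; _⟨$⟩ʳ_; _⟨$⟩ˡ_)
open import Data.Fin.Properties
  using (_≟_; toℕ<n; toℕ-fromℕ; toℕ-fromℕ<; toℕ-inject₁; toℕ-injective; toℕ-combine;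
         combine-injective; combine-surjective; opposite-involutive)
open import Data.Nat.Base
  using (ℕ; zero; suc; _+_; _*_; _∸_; _^_; _≤_; _<_; z≤n; s≤s; s≤s⁻¹)
open import Data.Nat.Divisibility using (_∣_; divides-refl; ∣m∣n⇒∣m+n; _∣0; ∣-refl)
open import Data.Nat.Properties as ℕ using (module ≤-Reasoning)
open import Data.Nat.Tactic.RingSolver using (solve-∀)
open import Data.Product using (∃; ∃!; _×_; _,_; proj₁; proj₂)
open import Data.Sum.Base using (_⊎_; inj₁; inj₂)
open import Data.Vec.Base using ([]; _∷_; lookup; map; replicate; tabulate)
open import Data.Vec.Properties
  using (updateAt-id-local; updateAt-updateAt; updateAt-commutes; lookup∘updateAt;
         lookup∘updateAt′; map-id; map-∘; map-cong; lookup-map; map-updateAt;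
         lookup-replicate; lookup∘tabulate; tabulate∘lookup; tabulate-cong)
open import Function.Base using (_∘_)
open import Function.Bundles
  using (_⤖_; module Bijection; module Equivalence; mk⇔; mk⤖; mk↔ₛ′)
open import Function.Consequences.Propositional using (strictlySurjective⇒surjective)
open import Function.Construct.Composition using (_⤖-∘_)
open import Function.Properties.Inverse using (↔⇒⤖)
open import Relation.Binary.PropositionalEquality
open import Relation.Nullary using (¬_; yes; no; contradiction)

private variable n : ℕ

-- Flips

origin : Vertex n
origin = replicate _ false

unit : Fin n → Vertex n
unit i = flipAt i origin

vertex-ext : {x y : Vertex n} → (∀ i → lookup x i ≡ lookup y i) → x ≡ y
vertex-ext {x = x} {y} p =
  trans (sym (tabulate∘lookup x)) (trans (tabulate-cong p) (tabulate∘lookup y))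

lookup-flip : ∀ i (x : Vertex n) → lookup (flipAt i x) i ≡ not (lookup x i)
lookup-flip i x = lookup∘updateAt i x

lookup-flip-≢ : ∀ {i j} → j ≢ i → (x : Vertex n) → lookup (flipAt i x) j ≡ lookup x j
lookup-flip-≢ j≢i x = lookup∘updateAt′ _ _ j≢i x

flip-involutive : ∀ i (x : Vertex n) → flipAt i (flipAt i x) ≡ x
flip-involutive i x =
  trans (updateAt-updateAt i x) (updateAt-id-local i x (not-involutive _))

flip-index : ∀ {i j} (x : Vertex n) → flipAt i x ≡ flipAt j x → i ≡ j
flip-index {i = i} {j} x p with i ≟ j
... | yes i≡j = i≡j
... | no i≢j = contradiction
  (trans (sym (lookup-flip-≢ i≢j x)) (trans (cong (λ y → lookup y i) (sym p)) (lookup-flip i x)))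
  (not-¬ refl)

-- The cube is connected under flips: the tail is changed first with the head fixed, then the head.
-- It shows that something constant along edges is constant on all vertices.
flip-induction : (P : Vertex n → Set) → (∀ i x → P x → P (flipAt i x)) →
                 ∀ x y → P x → P y
flip-induction P step [] [] p = p
flip-induction P step (b ∷ x) (c ∷ y) p = first b c
  (flip-induction (λ z → P (b ∷ z)) (λ i z → step (suc i) (b ∷ z)) x y p)
  where
  first : ∀ b c → P (b ∷ y) → P (c ∷ y)
  first false false q = q
  first false true  q = step zero (false ∷ y) q
  first true  false q = step zero (true ∷ y) q
  first true  true  q = q

-- Every vertex is reached from the origin by switching coordinates on only. This fits additive
-- laws, which speak of adding a coordinate that is still false.
up-induction : (P : Vertex n → Set) → P origin →
               (∀ i x → lookup x i ≡ false → P x → P (flipAt i x)) → ∀ x → P x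
up-induction P base step [] = base
up-induction P base step (b ∷ x) = first b
  (up-induction (λ z → P (false ∷ z)) base (λ i z → step (suc i) (false ∷ z)) x)
  where
  first : ∀ b → P (false ∷ x) → P (b ∷ x)
  first false q = q
  first true  q = step zero (false ∷ x) refl q

origin-or-true : (x : Vertex n) → x ≡ origin ⊎ ∃ λ i → lookup x i ≡ true
origin-or-true [] = inj₁ refl
origin-or-true (true ∷ x) = inj₂ (zero , refl)
origin-or-true (false ∷ x) with origin-or-true x
... | inj₁ x≡0 = inj₁ (cong (false ∷_) x≡0)
... | inj₂ (i , p) = inj₂ (suc i , p)

adjacent-flip : ∀ i (x : Vertex n) → Adjacent x (flipAt i x)
adjacent-flip i x = i , (λ p → not-¬ refl (trans p (lookup-flip i x))) , unique
  where
  unique : ∀ {j} → lookup x j ≢ lookup (flipAt i x) j → i ≡ j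
  unique {j} q with j ≟ i
  ... | yes j≡i = sym j≡i
  ... | no j≢i = contradiction (sym (lookup-flip-≢ j≢i x)) q

adjacent⇒flip : {x y : Vertex n} → Adjacent x y → ∃ λ i → y ≡ flipAt i x
adjacent⇒flip {x = x} {y} (i , p , unique) = i , vertex-ext eq
  where
  eq : ∀ j → lookup y j ≡ lookup (flipAt i x) j
  eq j with j ≟ i
  ... | yes refl = trans (¬-not (p ∘ sym)) (sym (lookup-flip i x))
  ... | no j≢i with lookup y j Bool.≟ lookup x j
  ...   | yes q = trans q (sym (lookup-flip-≢ j≢i x))
  ...   | no q = contradiction (sym (unique (q ∘ sym))) j≢i

-- The action of the hyperoctahedral group

module Hyp n = Group (HyperoctahedralGroup n)

-- Coordinates are permuted first and `c` is added afterwards. Position i takes its entry from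
-- position π⁻¹ i, so that the semidirect product acts by composition.
act : Hyp.Carrier n → Vertex n → Vertex n
act (c , π) x = tabulate λ i → c i xor lookup x (π ⟨$⟩ˡ i)

lookup-act : ∀ h (x : Vertex n) i →
             lookup (act h x) i ≡ proj₁ h i xor lookup x (proj₂ h ⟨$⟩ˡ i)
lookup-act h x = lookup∘tabulate _

act-cong : ∀ h k → Hyp._≈_ n h k → ∀ x → act h x ≡ act k x
act-cong (c , π) (d , ρ) (p , q) x = tabulate-cong λ i →
  cong₂ (λ b j → b xor lookup x j) (p i) (inverse-cong π ρ q i)

act-ε : (x : Vertex n) → act (Hyp.ε n) x ≡ x
act-ε = tabulate∘lookup

act-∙ : ∀ h k (x : Vertex n) → act (Hyp._∙_ n h k) x ≡ act h (act k x)
act-∙ (c , π) k@(d , ρ) x = tabulate-cong λ i →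
  trans (xor-assoc (c i) _ _) (cong (c i xor_) (sym (lookup-act k x (π ⟨$⟩ˡ i))))

act-inverseˡ : ∀ h (x : Vertex n) → act (Hyp._⁻¹ n h) (act h x) ≡ x
act-inverseˡ {n} h x =
  trans (sym (act-∙ (Hyp._⁻¹ n h) h x))
    (trans (act-cong (Hyp._∙_ n (Hyp._⁻¹ n h) h) (Hyp.ε n) (Hyp.inverseˡ n h) x) (act-ε x))

act-inverseʳ : ∀ h (x : Vertex n) → act h (act (Hyp._⁻¹ n h) x) ≡ x
act-inverseʳ {n} h x =
  trans (sym (act-∙ h (Hyp._⁻¹ n h) x))
    (trans (act-cong (Hyp._∙_ n h (Hyp._⁻¹ n h)) (Hyp.ε n) (Hyp.inverseʳ n h) x) (act-ε x))

not-xorʳ : ∀ a b → a xor not b ≡ not (a xor b)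
not-xorʳ true  b = refl
not-xorʳ false b = refl

-- The signs cancel along an edge, so the permutation alone moves edge directions, in the same way
-- at every vertex.
act-flip : ∀ h i (x : Vertex n) →
           act h (flipAt i x) ≡ flipAt (proj₂ h ⟨$⟩ʳ i) (act h x)
act-flip {n} h@(c , π) i x = vertex-ext eq
  where
  j = π ⟨$⟩ʳ i
  eq : ∀ k → lookup (act h (flipAt i x)) k ≡ lookup (flipAt j (act h x)) k
  eq k with k ≟ j
  ... | yes refl = begin
    lookup (act h (flipAt i x)) j             ≡⟨ lookup-act h (flipAt i x) j ⟩
    c j xor lookup (flipAt i x) (π ⟨$⟩ˡ j)    ≡⟨ cong (λ l → c j xor lookup (flipAt i x) l) π⁻¹j≡i ⟩
    c j xor lookup (flipAt i x) i             ≡⟨ cong (c j xor_) (lookup-flip i x) ⟩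
    c j xor not (lookup x i)                  ≡⟨ not-xorʳ (c j) _ ⟩
    not (c j xor lookup x i)                  ≡⟨ cong (λ l → not (c j xor lookup x l)) π⁻¹j≡i ⟨
    not (c j xor lookup x (π ⟨$⟩ˡ j))         ≡⟨ cong not (lookup-act h x j) ⟨
    not (lookup (act h x) j)                  ≡⟨ lookup-flip j (act h x) ⟨
    lookup (flipAt j (act h x)) j             ∎
    where
    open ≡-Reasoning
    π⁻¹j≡i = Perm.inverseˡ π {i}
  ... | no k≢j = begin
    lookup (act h (flipAt i x)) k             ≡⟨ lookup-act h (flipAt i x) k ⟩
    c k xor lookup (flipAt i x) (π ⟨$⟩ˡ k)    ≡⟨ cong (c k xor_) (lookup-flip-≢ π⁻¹k≢i x) ⟩
    c k xor lookup x (π ⟨$⟩ˡ k)               ≡⟨ lookup-act h x k ⟨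
    lookup (act h x) k                        ≡⟨ lookup-flip-≢ k≢j (act h x) ⟨
    lookup (flipAt j (act h x)) k             ∎
    where
    open ≡-Reasoning
    π⁻¹k≢i : π ⟨$⟩ˡ k ≢ i
    π⁻¹k≢i p = k≢j (trans (sym (Perm.inverseʳ π)) (cong (π ⟨$⟩ʳ_) p))

act-origin : ∀ h i → lookup (act {n} h origin) i ≡ proj₁ h i
act-origin h i = trans (lookup-act h origin i)
  (trans (cong (proj₁ h i xor_) (lookup-replicate (proj₂ h ⟨$⟩ˡ i) false)) (xor-identityʳ _))

-- The image of the origin recovers the signs, and the images of the edges at the origin recover the
-- permutation.
act-faithful : ∀ h k → (∀ x → act h x ≡ act k x) → Hyp._≈_ n h k
act-faithful h@(c , π) k@(d , ρ) p =
  (λ i → trans (sym (act-origin h i))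
    (trans (cong (λ x → lookup x i) (p origin)) (act-origin k i))) ,
  λ i → flip-index (act h origin)
    (trans (sym (act-flip h i origin))
      (trans (p (unit i))
        (trans (act-flip k i origin) (cong (flipAt (ρ ⟨$⟩ʳ i)) (sym (p origin))))))

act-adjacent : ∀ h (x y : Vertex n) → Adjacent x y → Adjacent (act h x) (act h y)
act-adjacent h x y a with i , refl ← adjacent⇒flip {x = x} {y} a =
  subst (Adjacent (act h x)) (sym (act-flip h i x)) (adjacent-flip _ (act h x))

fromHyp : Hyp.Carrier n → Automorphism n
fromHyp {n} h = record
  { permutation = mk↔ₛ′ (act h) (act (Hyp._⁻¹ n h)) (act-inverseʳ h) (act-inverseˡ h)
  ; adjacent⇔   = λ {x} {y} → mk⇔ (act-adjacent h x y) λ a →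
      subst₂ Adjacent (act-inverseˡ h x) (act-inverseˡ h y) (act-adjacent (Hyp._⁻¹ n h) (act h x) (act h y) a)
  }

-- Automorphisms of the hypercube graph

module Aut n = Group (Aut n)
open Automorphism

edge : ∀ (φ : Automorphism n) i x → ∃ λ j → to φ (flipAt i x) ≡ flipAt j (to φ x)
edge φ i x = adjacent⇒flip (Equivalence.to (adjacent⇔ φ) (adjacent-flip i x))

direction : Automorphism n → Vertex n → Fin n → Fin n
direction φ x i = proj₁ (edge φ i x)

to-flip : ∀ (φ : Automorphism n) x i → to φ (flipAt i x) ≡ flipAt (direction φ x i) (to φ x)
to-flip φ x i = proj₂ (edge φ i x)

to-injective : ∀ (φ : Automorphism n) {x y} → to φ x ≡ to φ y → x ≡ y
to-injective φ {x} {y} p =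
  trans (sym (strictlyInverseʳ φ x)) (trans (cong (from φ) p) (strictlyInverseʳ φ y))

-- Opposite edges of a 4-cycle are parallel: a, c are the directions of the
-- edges at y, and b, e those of the edges at the opposite corner.

square : ∀ {a b c e} (y : Vertex n) → a ≢ b → a ≢ c →
         flipAt b (flipAt a y) ≡ flipAt e (flipAt c y) → e ≡ a
square {a = a} {b} {c} {e} y a≢b a≢c p with e ≟ a
... | yes e≡a = e≡a
... | no e≢a = contradiction
  (trans (sym (trans (lookup-flip-≢ (e≢a ∘ sym) (flipAt c y)) (lookup-flip-≢ a≢c y)))
    (trans (cong (λ z → lookup z a) (sym p))
      (trans (lookup-flip-≢ a≢b (flipAt a y)) (lookup-flip a y))))
  (not-¬ refl)

-- For j = i this is one edge traversed backwards. Otherwise the two edges are opposite sides of a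
-- 4-cycle, so `square` applies; its inequalities hold because `to φ` is injective.
direction-flip : ∀ (φ : Automorphism n) x i j →
                 direction φ (flipAt j x) i ≡ direction φ x i
direction-flip φ x i j with i ≟ j
... | yes refl = sym (flip-index (flipAt d y) (trans (flip-involutive d y) (begin
    y                                            ≡⟨ cong (to φ) (flip-involutive i x) ⟨
    to φ (flipAt i (flipAt i x))                 ≡⟨ to-flip φ (flipAt i x) i ⟩
    flipAt d′ (to φ (flipAt i x))                ≡⟨ cong (flipAt d′) (to-flip φ x i) ⟩
    flipAt d′ (flipAt d y)                       ∎)))
  where
  open ≡-Reasoning
  y = to φ x
  d = direction φ x i
  d′ = direction φ (flipAt i x) i
... | no i≢j = square y d≢ d≢c (begin
    flipAt b (flipAt d y)            ≡⟨ cong (flipAt b) (to-flip φ x i) ⟨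
    flipAt b (to φ (flipAt i x))     ≡⟨ to-flip φ (flipAt i x) j ⟨
    to φ (flipAt j (flipAt i x))     ≡⟨ cong (to φ) (updateAt-commutes j i (i≢j ∘ sym) x) ⟩
    to φ (flipAt i (flipAt j x))     ≡⟨ to-flip φ (flipAt j x) i ⟩
    flipAt e (to φ (flipAt j x))     ≡⟨ cong (flipAt e) (to-flip φ x j) ⟩
    flipAt e (flipAt c y)            ∎)
  where
  open ≡-Reasoning
  y = to φ x
  d = direction φ x i
  c = direction φ x j
  b = direction φ (flipAt i x) j
  e = direction φ (flipAt j x) i
  d≢c : d ≢ c
  d≢c p = i≢j (flip-index x (to-injective φ
    (trans (to-flip φ x i) (trans (cong (λ k → flipAt k y) p) (sym (to-flip φ x j))))))
  d≢ : d ≢ b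
  d≢ p = i≢j (flip-index (flipAt i x) (trans (flip-involutive i x) (to-injective φ (begin
    y                               ≡⟨ flip-involutive d y ⟨
    flipAt d (flipAt d y)           ≡⟨ cong (flipAt d) (to-flip φ x i) ⟨
    flipAt d (to φ (flipAt i x))    ≡⟨ cong (λ k → flipAt k (to φ (flipAt i x))) p ⟩
    flipAt b (to φ (flipAt i x))    ≡⟨ to-flip φ (flipAt i x) j ⟨
    to φ (flipAt j (flipAt i x))    ∎))))

direction-constant : ∀ (φ : Automorphism n) x y i → direction φ x i ≡ direction φ y i
direction-constant φ x y i =
  flip-induction (λ z → direction φ x i ≡ direction φ z i)
    (λ j z p → trans p (sym (direction-flip φ z i j))) x y refl

-- `ψ` carries the image under `φ` of the edge from the origin to `unit i` back to that edge. Since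
-- directions are constant, those of `ψ` may be read at `to φ origin` instead of the origin.
direction-inverse : ∀ (φ ψ : Automorphism n) → (∀ x → to ψ (to φ x) ≡ x) →
                    ∀ i → direction ψ origin (direction φ origin i) ≡ i
direction-inverse φ ψ ψφ≗id i =
  trans (direction-constant ψ origin (to φ origin) _)
    (flip-index origin (begin
      flipAt k origin                      ≡⟨ cong (flipAt k) (ψφ≗id origin) ⟨
      flipAt k (to ψ (to φ origin))        ≡⟨ to-flip ψ (to φ origin) j ⟨
      to ψ (flipAt j (to φ origin))        ≡⟨ cong (to ψ) (to-flip φ origin i) ⟨
      to ψ (to φ (unit i))                 ≡⟨ ψφ≗id (unit i) ⟩
      flipAt i origin                      ∎))
  where
  open ≡-Reasoning
  j = direction φ origin i
  k = direction ψ (to φ origin) j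

toHyp : Automorphism n → Hyp.Carrier n
toHyp {n} φ = lookup (to φ origin) ,
  Perm.permutation (direction φ origin) (direction φ⁻¹ origin)
    (direction-inverse φ⁻¹ φ (strictlyInverseˡ φ))
    (direction-inverse φ φ⁻¹ (strictlyInverseʳ φ))
  where φ⁻¹ = Aut._⁻¹ n φ

-- Both maps agree at the origin and respond to each flip by a flip in the same direction.
act-toHyp : ∀ (φ : Automorphism n) x → act (toHyp φ) x ≡ to φ x
act-toHyp φ x = flip-induction (λ x → act (toHyp φ) x ≡ to φ x)
  (λ i x p → trans (act-flip (toHyp φ) i x)
    (trans (cong₂ flipAt (direction-constant φ origin x i) p) (sym (to-flip φ x i))))
  origin x (vertex-ext (act-origin (toHyp φ)))

-- This reduces the homomorphism laws to identities between maps on vertices.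
toHyp-unique : ∀ (φ : Automorphism n) h → (∀ x → to φ x ≡ act h x) → Hyp._≈_ n (toHyp φ) h
toHyp-unique φ h p = act-faithful (toHyp φ) h λ x → trans (act-toHyp φ x) (p x)

Aut≅HyperoctahedralGroup : ∀ n → Aut n ≅ HyperoctahedralGroup n
Aut≅HyperoctahedralGroup n = toHyp , record
  { isGroupMonomorphism = record
    { isGroupHomomorphism = record
      { isMonoidHomomorphism = record
        { isMagmaHomomorphism = record
          { isRelHomomorphism = record
            { cong = λ {φ} {ψ} p → toHyp-unique φ (toHyp ψ)
                λ x → trans (p x) (sym (act-toHyp ψ x)) }
          ; homo = λ φ ψ → toHyp-unique (Aut._∙_ n φ ψ) (Hyp._∙_ n (toHyp φ) (toHyp ψ)) λ x →
              sym (trans (act-∙ (toHyp φ) (toHyp ψ) x)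
                (trans (act-toHyp φ _) (cong (to φ) (act-toHyp ψ x))))
          }
        ; ε-homo = toHyp-unique (Aut.ε n) (Hyp.ε n) λ x → sym (act-ε x)
        }
      ; ⁻¹-homo = λ φ → toHyp-unique (Aut._⁻¹ n φ) (Hyp._⁻¹ n (toHyp φ)) λ x →
          trans (sym (act-inverseˡ (toHyp φ) (from φ x)))
            (cong (act (Hyp._⁻¹ n (toHyp φ)))
              (trans (act-toHyp φ (from φ x)) (strictlyInverseˡ φ x)))
      }
    ; injective = λ {φ} {ψ} p x →
        trans (sym (act-toHyp φ x)) (trans (act-cong (toHyp φ) (toHyp ψ) p x) (act-toHyp ψ x))
    }
  ; surjective = λ h → fromHyp h , λ {φ} p → toHyp-unique φ h p
  }

-- Labelings satisfying the parallelogram law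

Parallelogram : (Vertex n → ℕ) → Set
Parallelogram F = ∀ x i j → i ≢ j →
  F x + F (flipAt i (flipAt j x)) ≡ F (flipAt i x) + F (flipAt j x)

-- Parallel edges in direction i have equal increments, so each can be compared with the edge at the
-- origin. `F origin` is added on the left to avoid subtraction.
parallelogram⇒additive : (F : Vertex n → ℕ) → Parallelogram F →
  ∀ i x → lookup x i ≡ false → F (flipAt i x) + F origin ≡ F x + F (unit i)
parallelogram⇒additive F par i =
  up-induction _ (λ _ → ℕ.+-comm (F (unit i)) (F origin)) step
  where
  -- Here a, b, c, d are the values at x and at x with both, with i, and with j flipped; o and e are
  -- the values at the origin and at `unit i`.
  cancel : ∀ a b c d o e → a + b ≡ c + d → c + o ≡ a + e → b + o ≡ d + e
  cancel a b c d o e p q = ℕ.+-cancelˡ-≡ a _ _ (begin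
    a + (b + o)  ≡⟨ ℕ.+-assoc a b o ⟨
    a + b + o    ≡⟨ cong (_+ o) p ⟩
    c + d + o    ≡⟨ swap c d o ⟩
    d + (c + o)  ≡⟨ cong (d +_) q ⟩
    d + (a + e)  ≡⟨ ℕ.+-assoc d a e ⟨
    d + a + e    ≡⟨ swap d a e ⟩
    a + (d + e)  ∎)
    where
    open ≡-Reasoning
    swap : ∀ x y z → x + y + z ≡ y + (x + z)
    swap = solve-∀
  step : ∀ j x → lookup x j ≡ false →
    (lookup x i ≡ false → F (flipAt i x) + F origin ≡ F x + F (unit i)) →
    lookup (flipAt j x) i ≡ false →
    F (flipAt i (flipAt j x)) + F origin ≡ F (flipAt j x) + F (unit i)
  step j x xⱼ ih yᵢ with i ≟ j
  ... | yes refl = contradiction (trans (sym yᵢ) (lookup-flip i x)) (not-¬ (sym xⱼ))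
  ... | no i≢j = cancel (F x) _ _ _ _ _ (par x i j i≢j)
    (ih (trans (sym (lookup-flip-≢ i≢j x)) yᵢ))

-- Binary expansion

bit : Bool → Fin 2
bit false = zero
bit true  = suc zero

binary : Vertex n → Fin (2 ^ n)
binary []      = zero
binary (b ∷ x) = combine (bit b) (binary x)

value : Vertex n → ℕ
value x = toℕ (binary x)

value-∷ : ∀ b (x : Vertex n) → value (b ∷ x) ≡ 2 ^ n * toℕ (bit b) + value x
value-∷ b x = toℕ-combine (bit b) (binary x)

binary-injective : {x y : Vertex n} → binary x ≡ binary y → x ≡ y
binary-injective {x = []} {[]} _ = refl
binary-injective {x = b ∷ x} {c ∷ y} p
  with q , r ← combine-injective (bit b) (binary x) (bit c) (binary y) p =
  cong₂ _∷_ (bit-injective b c q) (binary-injective r)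
  where
  bit-injective : ∀ b c → bit b ≡ bit c → b ≡ c
  bit-injective false false _ = refl
  bit-injective true  true  _ = refl

binary-surjective : (k : Fin (2 ^ n)) → ∃ λ (x : Vertex n) → binary x ≡ k
binary-surjective {zero} zero = [] , refl
binary-surjective {suc n} k with combine-surjective {2} k
... | b , l , p with x , q ← binary-surjective l =
  not-zero b ∷ x , trans (cong₂ combine (bit-not-zero b) q) p
  where
  not-zero : Fin 2 → Bool
  not-zero zero = false
  not-zero (suc zero) = true
  bit-not-zero : ∀ b → bit (not-zero b) ≡ b
  bit-not-zero zero = refl
  bit-not-zero (suc zero) = refl

value-injective : {x y : Vertex n} → value x ≡ value y → x ≡ y
value-injective = binary-injective ∘ toℕ-injective

value-origin : ∀ n → value (origin {n}) ≡ 0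
value-origin zero = refl
value-origin (suc n) = begin
  value (origin {suc n})       ≡⟨ value-∷ false (origin {n}) ⟩
  2 ^ n * 0 + value (origin {n}) ≡⟨ cong₂ _+_ (ℕ.*-zeroʳ (2 ^ n)) (value-origin n) ⟩
  0                            ∎
  where open ≡-Reasoning

-- The head is the most significant bit, so exponents run against the order of the indices.
value-unit : (i : Fin n) → value (unit i) ≡ 2 ^ toℕ (opposite i)
value-unit {suc n} zero = begin
  value (unit {suc n} zero)       ≡⟨ value-∷ true (origin {n}) ⟩
  2 ^ n * 1 + value (origin {n})  ≡⟨ cong₂ _+_ (ℕ.*-identityʳ (2 ^ n)) (value-origin n) ⟩
  2 ^ n + 0                       ≡⟨ ℕ.+-identityʳ (2 ^ n) ⟩
  2 ^ n                           ≡⟨ cong (2 ^_) (toℕ-fromℕ n) ⟨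
  2 ^ toℕ (opposite {suc n} zero) ∎
  where open ≡-Reasoning
value-unit {suc n} (suc i) = begin
  value (unit (suc i))               ≡⟨ value-∷ false (unit i) ⟩
  2 ^ n * 0 + value (unit i)         ≡⟨ cong₂ _+_ (ℕ.*-zeroʳ (2 ^ n)) (value-unit i) ⟩
  2 ^ toℕ (opposite i)               ≡⟨ cong (2 ^_) (toℕ-inject₁ (opposite i)) ⟨
  2 ^ toℕ (opposite (suc i))         ∎
  where open ≡-Reasoning

-- Each binary place holds a 1 in exactly one of the two numbers, so they sum to 2 ^ n - 1.
value-complement : (x : Vertex n) → suc (value x + value (map not x)) ≡ 2 ^ n
value-complement [] = refl
value-complement {suc n} (b ∷ x) = begin
  suc (value (b ∷ x) + value (not b ∷ map not x))
    ≡⟨ cong suc (cong₂ _+_ (value-∷ b x) (value-∷ (not b) (map not x))) ⟩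
  suc ((N * toℕ (bit b) + v) + (N * toℕ (bit (not b)) + v′))
    ≡⟨ regroup N (toℕ (bit b)) (toℕ (bit (not b))) v v′ ⟩
  N * (toℕ (bit b) + toℕ (bit (not b))) + suc (v + v′)
    ≡⟨ cong₂ _+_ (cong (N *_) (one b)) (value-complement x) ⟩
  N * 1 + N
    ≡⟨ double N ⟩
  2 ^ suc n ∎
  where
  open ≡-Reasoning
  N = 2 ^ n
  v = value x
  v′ = value (map not x)
  regroup : ∀ N b c v w → suc ((N * b + v) + (N * c + w)) ≡ N * (b + c) + suc (v + w)
  regroup = solve-∀
  double : ∀ N → N * 1 + N ≡ 2 * N
  double = solve-∀
  one : ∀ b → toℕ (bit b) + toℕ (bit (not b)) ≡ 1
  one false = refl
  one true  = refl

value-parallelogram : Parallelogram (value {n})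
value-parallelogram x zero zero 0≢0 = contradiction refl 0≢0
value-parallelogram {suc n} (b ∷ x) zero (suc j) _
  rewrite value-∷ b x | value-∷ (not b) (flipAt j x) | value-∷ (not b) x | value-∷ b (flipAt j x) =
  regroup (2 ^ n * toℕ (bit b)) (2 ^ n * toℕ (bit (not b))) (value x) (value (flipAt j x))
  where
  regroup : ∀ b c v w → (b + v) + (c + w) ≡ (c + v) + (b + w)
  regroup = solve-∀
value-parallelogram {suc n} (b ∷ x) (suc i) zero _
  rewrite value-∷ b x | value-∷ (not b) (flipAt i x) | value-∷ (not b) x | value-∷ b (flipAt i x) =
  regroup (2 ^ n * toℕ (bit b)) (2 ^ n * toℕ (bit (not b))) (value x) (value (flipAt i x))
  where
  regroup : ∀ b c v w → (b + v) + (c + w) ≡ (b + w) + (c + v)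
  regroup = solve-∀
value-parallelogram {suc n} (b ∷ x) (suc i) (suc j) i≢j
  rewrite value-∷ b x | value-∷ b (flipAt i (flipAt j x))
        | value-∷ b (flipAt i x) | value-∷ b (flipAt j x) = begin
  (B + value x) + (B + value (flipAt i (flipAt j x)))
    ≡⟨ regroup B (value x) _ ⟩
  B + B + (value x + value (flipAt i (flipAt j x)))
    ≡⟨ cong (B + B +_) (value-parallelogram x i j (i≢j ∘ cong suc)) ⟩
  B + B + (value (flipAt i x) + value (flipAt j x))
    ≡⟨ regroup B (value (flipAt i x)) _ ⟨
  (B + value (flipAt i x)) + (B + value (flipAt j x)) ∎
  where
  open ≡-Reasoning
  B = 2 ^ n * toℕ (bit b)
  regroup : ∀ B v w → (B + v) + (B + w) ≡ B + B + (v + w)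
  regroup = solve-∀

-- Additive bijections onto 0, …, 2 ^ n ∸ 1

-- A vertex stands for the set of its true coordinates, and `F` for the subset sum of the weights
-- `F (unit i)`.
record AdditiveBijection (F : Vertex n → ℕ) : Set where
  field
    F-origin   : F origin ≡ 0
    additive   : ∀ i x → lookup x i ≡ false → F (flipAt i x) ≡ F x + F (unit i)
    injective  : ∀ {x y} → F x ≡ F y → x ≡ y
    surjective : ∀ m → m < 2 ^ n → ∃ λ x → F x ≡ m
    bounded    : ∀ x → F x < 2 ^ n

_⊆_ : Vertex n → Vertex n → Set
x ⊆ y = ∀ i → lookup x i ≡ true → lookup y i ≡ true

false≢true : {b : Bool} → b ≡ false → b ≢ true
false≢true refl ()

lookup-unit : (i : Fin n) → lookup (unit i) i ≡ true
lookup-unit i = trans (lookup-flip i origin) (cong not (lookup-replicate i false))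

flip-⊆ : ∀ i (x y : Vertex n) → lookup x i ≡ true → flipAt i x ⊆ y → lookup y i ≡ true → x ⊆ y
flip-⊆ i x y xᵢ x⊆y yᵢ j xⱼ with j ≟ i
... | yes refl = yᵢ
... | no j≢i = x⊆y j (trans (lookup-flip-≢ j≢i x) xⱼ)

⊆-flip : ∀ i (x y : Vertex n) → lookup y i ≡ false → x ⊆ y → x ⊆ flipAt i y
⊆-flip i x y yᵢ x⊆y j xⱼ = trans (lookup-flip-≢ j≢i y) (x⊆y j xⱼ)
  where
  j≢i : j ≢ i
  j≢i refl = false≢true yᵢ (x⊆y j xⱼ)

flip-⊆-flip : ∀ i (x y : Vertex n) → lookup y i ≡ false → x ⊆ y → flipAt i x ⊆ flipAt i y
flip-⊆-flip i x y yᵢ x⊆y j xⱼ with j ≟ i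
... | yes refl = trans (lookup-flip i y) (cong not yᵢ)
... | no j≢i = trans (lookup-flip-≢ j≢i y) (x⊆y j (trans (sym (lookup-flip-≢ j≢i x)) xⱼ))

-- Weights whose subset sums are 0, ..., 2 ^ n - 1

module Weights {F : Vertex n → ℕ} (F-additive : AdditiveBijection F) where
  open AdditiveBijection F-additive

  weight : Fin n → ℕ
  weight i = F (unit i)

  remove : ∀ i x → lookup x i ≡ true → F x ≡ F (flipAt i x) + weight i
  remove i x xᵢ = trans (cong F (sym (flip-involutive i x)))
    (additive i (flipAt i x) (trans (lookup-flip i x) (cong not xᵢ)))

  weight-≤ : ∀ i x → lookup x i ≡ true → weight i ≤ F x
  weight-≤ i x xᵢ = subst (weight i ≤_) (sym (remove i x xᵢ)) (ℕ.m≤n+m (weight i) _)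

  weight-injective : ∀ {i j} → weight i ≡ weight j → i ≡ j
  weight-injective = flip-index origin ∘ injective

  weight-positive : ∀ i → 0 < weight i
  weight-positive i = ℕ.n≢0⇒n>0 λ p → false≢true (lookup-replicate i false)
    (trans (cong (λ x → lookup x i) (injective (trans F-origin (sym p)))) (lookup-unit i))

  -- Weights are natural numbers, so enlarging a set cannot lower its sum. When `y` gains coordinate
  -- i, that coordinate is removed from `x` as well if it is present.
  ⊆⇒≤ : ∀ y x → x ⊆ y → F x ≤ F y
  ⊆⇒≤ = up-induction _ base step
    where
    base : ∀ x → x ⊆ origin → F x ≤ F origin
    base x x⊆0 with origin-or-true x
    ... | inj₁ refl = ℕ.≤-refl
    ... | inj₂ (i , xᵢ) = contradiction (x⊆0 i xᵢ) (false≢true (lookup-replicate i false))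
    step : ∀ i y → lookup y i ≡ false → (∀ x → x ⊆ y → F x ≤ F y) →
           ∀ x → x ⊆ flipAt i y → F x ≤ F (flipAt i y)
    step i y yᵢ ih x x⊆ with lookup x i in xᵢ
    ... | true = begin
      F x                         ≡⟨ remove i x xᵢ ⟩
      F (flipAt i x) + weight i   ≤⟨ ℕ.+-monoˡ-≤ (weight i) (ih (flipAt i x) x′⊆y) ⟩
      F y + weight i              ≡⟨ additive i y yᵢ ⟨
      F (flipAt i y)              ∎
      where
      open ≤-Reasoning
      x′⊆y : flipAt i x ⊆ y
      x′⊆y j p with j ≟ i
      ... | yes refl = contradiction p (false≢true (trans (lookup-flip i x) (cong not xᵢ)))
      ... | no j≢i = trans (sym (lookup-flip-≢ j≢i y)) (x⊆ j (trans (sym (lookup-flip-≢ j≢i x)) p))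
    ... | false = begin
      F x               ≤⟨ ih x x⊆y ⟩
      F y               ≤⟨ ℕ.m≤m+n (F y) (weight i) ⟩
      F y + weight i    ≡⟨ additive i y yᵢ ⟨
      F (flipAt i y)    ∎
      where
      open ≤-Reasoning
      x⊆y : x ⊆ y
      x⊆y j p with j ≟ i
      ... | yes refl = contradiction p (false≢true xᵢ)
      ... | no j≢i = trans (sym (lookup-flip-≢ j≢i y)) (x⊆ j p)

  -- The vertices with F x < 2 ^ k are those of the face spanned by origin and top.
  -- If a coordinate i of the vertex x with F x ≡ 2 ^ k had weight below 2 ^ k, then
  -- x would lie in this face and F x would be at most F top. Hence i has weight
  -- 2 ^ k and enlarges the face.

  record Face (k : ℕ) : Set where
    field
      top      : Vertex n
      F-top    : suc (F top) ≡ 2 ^ k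
      below    : ∀ x → F x < 2 ^ k → x ⊆ top
      powers   : ∀ i → lookup top i ≡ true → ∃ λ l → l < k × weight i ≡ 2 ^ l
      complete : ∀ l → l < k → ∃ λ i → weight i ≡ 2 ^ l

  face-zero : Face 0
  face-zero = record
    { top      = origin
    ; F-top    = cong suc F-origin
    ; below    = below
    ; powers   = λ i p → contradiction p (false≢true (lookup-replicate i false))
    ; complete = λ l ()
    }
    where
    below : ∀ x → F x < 1 → x ⊆ origin
    below x (s≤s Fx≤0) i xᵢ =
      contradiction (ℕ.≤-trans (weight-≤ i x xᵢ) Fx≤0) (ℕ.<⇒≱ (weight-positive i))

  face-suc : ∀ {k} → k < n → Face k → Face (suc k)
  face-suc {k} k<n face with surjective (2 ^ k) (ℕ.^-monoʳ-< 2 (s≤s (s≤s z≤n)) k<n)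
  ... | x , Fx≡ with origin-or-true x
  ...   | inj₁ refl = contradiction (trans (sym Fx≡) F-origin) (ℕ.>⇒≢ (ℕ.m^n>0 2 k))
  ...   | inj₂ (i , xᵢ) = record
    { top      = flipAt i top
    ; F-top    = trans (cong suc (trans (additive i top topᵢ) (cong (F top +_) weight≡)))
        (trans (cong (_+ 2 ^ k) F-top) (cong (2 ^ k +_) (sym (ℕ.+-identityʳ (2 ^ k)))))
    ; below    = below′
    ; powers   = powers′
    ; complete = complete′
    }
    where
    open Face face
    F-top< : F top < 2 ^ k
    F-top< = ℕ.≤-reflexive F-top
    -- Removing the positive weight of i from the sum 2 ^ k leaves less than 2 ^ k, so the rest of x
    -- lies in the face.
    x′-below : F (flipAt i x) < 2 ^ k
    x′-below = subst (F (flipAt i x) <_) (trans (sym (remove i x xᵢ)) Fx≡)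
      (ℕ.m<m+n _ (weight-positive i))
    weight≮ : ¬ (weight i < 2 ^ k)
    weight≮ wᵢ< = ℕ.<⇒≱ F-top< (subst (_≤ F top) Fx≡
      (⊆⇒≤ top x (flip-⊆ i x top xᵢ (below _ x′-below) (below _ wᵢ< i (lookup-unit i)))))
    weight≡ : weight i ≡ 2 ^ k
    weight≡ = ℕ.≤-antisym (subst (weight i ≤_) Fx≡ (weight-≤ i x xᵢ)) (ℕ.≮⇒≥ weight≮)
    topᵢ : lookup top i ≡ false
    topᵢ with lookup top i in p
    ... | false = refl
    ... | true = contradiction (ℕ.≤-<-trans (weight-≤ i top p) F-top<) weight≮
    below′ : ∀ y → F y < 2 ^ suc k → y ⊆ flipAt i top
    below′ y Fy< with F y ℕ.<? 2 ^ k
    ... | yes Fy<2^k = ⊆-flip i y top topᵢ (below y Fy<2^k)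
    -- The remainder F y - 2 ^ k is attained at some z in the face. Adding i to z restores the value
    -- F y, so by injectivity the result is y.
    ... | no Fy≮2^k = subst (_⊆ flipAt i top) z′≡y (flip-⊆-flip i z top topᵢ z⊆top)
      where
      m = F y ∸ 2 ^ k
      m+2^k≡Fy : m + 2 ^ k ≡ F y
      m+2^k≡Fy = ℕ.m∸n+n≡m (ℕ.≮⇒≥ Fy≮2^k)
      m<2^k : m < 2 ^ k
      m<2^k = ℕ.+-cancelʳ-< (2 ^ k) _ _ (subst₂ _<_ (sym m+2^k≡Fy)
        (cong (2 ^ k +_) (ℕ.+-identityʳ (2 ^ k))) Fy<)
      z,Fz≡m = surjective m (ℕ.<-trans m<2^k (ℕ.^-monoʳ-< 2 (s≤s (s≤s z≤n)) k<n))
      z = proj₁ z,Fz≡m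
      Fz≡m = proj₂ z,Fz≡m
      z⊆top : z ⊆ top
      z⊆top = below z (subst (_< 2 ^ k) (sym Fz≡m) m<2^k)
      zᵢ : lookup z i ≡ false
      zᵢ with lookup z i in p
      ... | false = refl
      ... | true = contradiction (z⊆top i p) (false≢true topᵢ)
      z′≡y : flipAt i z ≡ y
      z′≡y = injective (trans (additive i z zᵢ) (trans (cong₂ _+_ Fz≡m weight≡) m+2^k≡Fy))
    powers′ : ∀ j → lookup (flipAt i top) j ≡ true → ∃ λ l → l < suc k × weight j ≡ 2 ^ l
    powers′ j p with j ≟ i
    ... | yes refl = k , ℕ.n<1+n k , weight≡
    ... | no j≢i with l , l<k , q ← powers j (trans (sym (lookup-flip-≢ j≢i top)) p) =
      l , ℕ.m<n⇒m<1+n l<k , q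
    complete′ : ∀ l → l < suc k → ∃ λ j → weight j ≡ 2 ^ l
    complete′ l l<1+k with l ℕ.≟ k
    ... | yes refl = i , weight≡
    ... | no l≢k = complete l (ℕ.≤∧≢⇒< (s≤s⁻¹ l<1+k) l≢k)

  face : ∀ k → k ≤ n → Face k
  face zero    _   = face-zero
  face (suc k) k<n = face-suc k<n (face k (ℕ.<⇒≤ k<n))

  -- All values lie below 2 ^ n, so this last face contains every unit vertex: all weights are
  -- powers of 2 with exponent below n, and each such power occurs.
  open Face (face n ℕ.≤-refl)

  weight⇒value : ∀ i → ∃ λ j → weight i ≡ value (unit j)
  weight⇒value i with l , l<n , p ← powers i (below (unit i) (bounded (unit i)) i (lookup-unit i)) =
    opposite (fromℕ< l<n) , trans p (sym (trans (value-unit (opposite (fromℕ< l<n)))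
      (cong (2 ^_) (trans (cong toℕ (opposite-involutive (fromℕ< l<n))) (toℕ-fromℕ< l<n)))))

  value⇒weight : ∀ j → ∃ λ i → weight i ≡ value (unit j)
  value⇒weight j with i , p ← complete (toℕ (opposite j)) (toℕ<n (opposite j)) =
    i , trans p (sym (value-unit j))

  coordinates : Permutation′ n
  coordinates = Perm.permutation (proj₁ ∘ weight⇒value) (proj₁ ∘ value⇒weight)
    (λ j → flip-index origin (value-injective
      (trans (sym (proj₂ (weight⇒value _))) (proj₂ (value⇒weight j)))))
    (λ i → weight-injective
      (trans (proj₂ (value⇒weight _)) (sym (proj₂ (weight⇒value i)))))

  -- Both sides vanish at the origin and gain the same weight whenever a coordinate is switched on.
  F≡value : ∀ x → F x ≡ value (act ((λ _ → false) , coordinates) x)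
  F≡value = up-induction _
      (trans F-origin (trans (sym (value-origin n)) (cong value (sym h-origin))))
      λ i x xᵢ p → begin
        F (flipAt i x)                                ≡⟨ additive i x xᵢ ⟩
        F x + weight i                                ≡⟨ cong₂ _+_ p (proj₂ (weight⇒value i)) ⟩
        value (act h x) + value (unit (π ⟨$⟩ʳ i))     ≡⟨ value-additive (π ⟨$⟩ʳ i) (act h x) (h-false i x xᵢ) ⟨
        value (flipAt (π ⟨$⟩ʳ i) (act h x))           ≡⟨ cong value (act-flip h i x) ⟨
        value (act h (flipAt i x))                    ∎
    where
    open ≡-Reasoning
    π = coordinates
    h = (λ _ → false) , π
    h-origin : act h origin ≡ origin
    h-origin = vertex-ext λ i → trans (act-origin h i) (sym (lookup-replicate i false))
    h-false : ∀ i x → lookup x i ≡ false → lookup (act h x) (π ⟨$⟩ʳ i) ≡ false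
    h-false i x xᵢ = trans (lookup-act h x (π ⟨$⟩ʳ i))
      (trans (cong (lookup x) (Perm.inverseˡ π)) xᵢ)
    value-additive : ∀ i x → lookup x i ≡ false → value (flipAt i x) ≡ value x + value (unit i)
    value-additive i x xᵢ = begin
      value (flipAt i x)                        ≡⟨ ℕ.+-identityʳ _ ⟨
      value (flipAt i x) + 0                    ≡⟨ cong (value (flipAt i x) +_) (value-origin n) ⟨
      value (flipAt i x) + value (origin {n})   ≡⟨ parallelogram⇒additive value value-parallelogram i x xᵢ ⟩
      value x + value (unit i)                  ∎

-- Parity and the twist

-- The antipodal map for `true` and the identity for `false`, in a form that lets the choice depend
-- on a parity.
shift : Bool → Vertex n → Vertex n
shift b = map (b xor_)

parity : Vertex n → Bool
parity []      = false
parity (b ∷ x) = b xor parity x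

xor-cancelˡ : ∀ a b → a xor (a xor b) ≡ b
xor-cancelˡ a b = trans (sym (xor-assoc a a b)) (cong (_xor b) (xor-same a))

shift-shift : ∀ b c (x : Vertex n) → shift b (shift c x) ≡ shift (b xor c) x
shift-shift b c x =
  trans (sym (map-∘ (b xor_) (c xor_) x)) (map-cong (λ d → sym (xor-assoc b c d)) x)

shift-comm : ∀ b c (x : Vertex n) → shift b (shift c x) ≡ shift c (shift b x)
shift-comm b c x = trans (shift-shift b c x)
  (trans (cong (λ d → shift d x) (xor-comm b c)) (sym (shift-shift c b x)))

shift-involutive : ∀ b (x : Vertex n) → shift b (shift b x) ≡ x
shift-involutive b x =
  trans (shift-shift b b x) (trans (cong (λ d → shift d x) (xor-same b)) (map-id x))

shift-flip : ∀ b i (x : Vertex n) → shift b (flipAt i x) ≡ flipAt i (shift b x)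
shift-flip b i x = map-updateAt x i (not-xorʳ b (lookup x i))

antipodal-shift : (x : Vertex n) → Antipodal x (shift true x)
antipodal-shift x i p = not-¬ refl (trans p (lookup-map i not x))

antipodal⇒shift : ∀ (x y : Vertex n) → Antipodal x y → y ≡ shift true x
antipodal⇒shift x y a =
  vertex-ext λ i → trans (¬-not (a i ∘ sym)) (sym (lookup-map i not x))

shift≡act : ∀ b (x : Vertex n) → shift b x ≡ act ((λ _ → b) , Perm.id) x
shift≡act b x = vertex-ext λ i →
  trans (lookup-map i (b xor_) x) (sym (lookup-act ((λ _ → b) , Perm.id) x i))

act-shift : ∀ h b (x : Vertex n) → act h (shift b x) ≡ shift b (act h x)
act-shift h@(c , π) b x = vertex-ext λ i → begin
  lookup (act h (shift b x)) i             ≡⟨ lookup-act h (shift b x) i ⟩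
  c i xor lookup (shift b x) (π ⟨$⟩ˡ i)    ≡⟨ cong (c i xor_) (lookup-map (π ⟨$⟩ˡ i) (b xor_) x) ⟩
  c i xor (b xor lookup x (π ⟨$⟩ˡ i))      ≡⟨ xor-assoc (c i) b _ ⟨
  (c i xor b) xor lookup x (π ⟨$⟩ˡ i)      ≡⟨ cong (_xor lookup x (π ⟨$⟩ˡ i)) (xor-comm (c i) b) ⟩
  (b xor c i) xor lookup x (π ⟨$⟩ˡ i)      ≡⟨ xor-assoc b (c i) _ ⟩
  b xor (c i xor lookup x (π ⟨$⟩ˡ i))      ≡⟨ cong (b xor_) (lookup-act h x i) ⟨
  b xor lookup (act h x) i                 ≡⟨ lookup-map i (b xor_) (act h x) ⟨
  lookup (shift b (act h x)) i             ∎
  where open ≡-Reasoning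

parity-flip : ∀ i (x : Vertex n) → parity (flipAt i x) ≡ not (parity x)
parity-flip zero    (true ∷ x)  = sym (not-involutive _)
parity-flip zero    (false ∷ x) = refl
parity-flip (suc i) (b ∷ x) = trans (cong (b xor_) (parity-flip i x)) (not-xorʳ b _)

parity-origin : ∀ n → parity (origin {n}) ≡ false
parity-origin zero    = refl
parity-origin (suc n) = parity-origin n

-- A flip changes both parities, so their difference is the same at every vertex and can be read at
-- the origin.
parity-act : ∀ h (x : Vertex n) → parity (act h x) ≡ parity (act h origin) xor parity x
parity-act {n} h x = flip-induction (λ x → parity (act h x) ≡ q xor parity x) step origin x
  (sym (trans (cong (q xor_) (parity-origin n)) (xor-identityʳ q)))
  where
  open ≡-Reasoning
  q = parity (act h (origin {n}))
  step : ∀ i x → parity (act h x) ≡ q xor parity x →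
         parity (act h (flipAt i x)) ≡ q xor parity (flipAt i x)
  step i x p = begin
    parity (act h (flipAt i x))                    ≡⟨ cong parity (act-flip h i x) ⟩
    parity (flipAt (proj₂ h ⟨$⟩ʳ i) (act h x))     ≡⟨ parity-flip (proj₂ h ⟨$⟩ʳ i) (act h x) ⟩
    not (parity (act h x))                         ≡⟨ cong not p ⟩
    not (q xor parity x)                           ≡⟨ not-xorʳ q (parity x) ⟨
    q xor not (parity x)                           ≡⟨ cong (q xor_) (parity-flip i x) ⟨
    q xor parity (flipAt i x)                      ∎

odd : ℕ → Bool
odd zero    = false
odd (suc n) = not (odd n)

parity-complement : (x : Vertex n) → parity (shift true x) ≡ odd n xor parity x
parity-complement [] = refl
parity-complement {suc n} (b ∷ x) = begin
  not b xor parity (shift true x)  ≡⟨ cong (not b xor_) (parity-complement x) ⟩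
  not b xor (odd n xor parity x)   ≡⟨ move b (odd n) (parity x) ⟩
  not (odd n) xor (b xor parity x) ∎
  where
  open ≡-Reasoning
  move : ∀ b o p → not b xor (o xor p) ≡ not o xor (b xor p)
  move false false p = refl
  move false true  p = not-involutive p
  move true  false p = sym (not-involutive p)
  move true  true  p = refl

2∣⇒odd≡false : 2 ∣ n → odd n ≡ false
2∣⇒odd≡false (divides-refl q) = go q
  where
  go : ∀ q → odd (q * 2) ≡ false
  go zero    = refl
  go (suc q) = trans (not-involutive _) (go q)

odd≡false⇒2∣ : ∀ n → odd n ≡ false → 2 ∣ n
odd≡false⇒2∣ zero          _ = 2 ∣0
odd≡false⇒2∣ (suc (suc n)) p =
  ∣m∣n⇒∣m+n ∣-refl (odd≡false⇒2∣ n (trans (sym (not-involutive _)) p))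

2∤⇒odd≡true : ¬ (2 ∣ n) → odd n ≡ true
2∤⇒odd≡true {n} 2∤n = ¬-not (2∤n ∘ odd≡false⇒2∣ n)

twist : Vertex n → Vertex n
twist x = shift (parity x) x

-- A flip reverses the parity and so brings in one antipodal map; after two flips these maps cancel.
twist-flip : ∀ i (x : Vertex n) → twist (flipAt i x) ≡ shift true (flipAt i (twist x))
twist-flip i x = begin
  shift (parity (flipAt i x)) (flipAt i x)       ≡⟨ cong (λ b → shift b (flipAt i x)) (parity-flip i x) ⟩
  shift (not (parity x)) (flipAt i x)            ≡⟨ shift-shift true (parity x) (flipAt i x) ⟨
  shift true (shift (parity x) (flipAt i x))     ≡⟨ cong (shift true) (shift-flip (parity x) i x) ⟩
  shift true (flipAt i (twist x))                ∎
  where open ≡-Reasoning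

twist-flip-flip : ∀ i j (x : Vertex n) →
                  twist (flipAt i (flipAt j x)) ≡ flipAt i (flipAt j (twist x))
twist-flip-flip i j x = begin
  twist (flipAt i (flipAt j x))                                ≡⟨ twist-flip i (flipAt j x) ⟩
  shift true (flipAt i (twist (flipAt j x)))                   ≡⟨ cong (shift true ∘ flipAt i) (twist-flip j x) ⟩
  shift true (flipAt i (shift true (flipAt j (twist x))))      ≡⟨ cong (shift true) (shift-flip true i _) ⟨
  shift true (shift true (flipAt i (flipAt j (twist x))))      ≡⟨ shift-involutive true _ ⟩
  flipAt i (flipAt j (twist x))                                ∎
  where open ≡-Reasoning

-- In odd dimension the antipodal map reverses the parity, and the resulting change of shift undoes
-- the map itself.
twist-complement-odd : odd n ≡ true → (x : Vertex n) → twist (shift true x) ≡ twist x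
twist-complement-odd n-odd x = begin
  shift (parity (shift true x)) (shift true x)  ≡⟨ shift-shift (parity (shift true x)) true x ⟩
  shift (parity (shift true x) xor true) x      ≡⟨ cong (λ b → shift b x) parity≡ ⟩
  shift (parity x) x                            ∎
  where
  open ≡-Reasoning
  parity≡ : parity (shift true x) xor true ≡ parity x
  parity≡ = trans (cong (_xor true) (trans (parity-complement x) (cong (_xor parity x) n-odd)))
    (trans (xor-comm (not (parity x)) true) (not-involutive (parity x)))

module _ (n-even : odd n ≡ false) where

  parity-shift : ∀ b (x : Vertex n) → parity (shift b x) ≡ parity x
  parity-shift false x = cong parity (map-id x)
  parity-shift true  x = trans (parity-complement x) (cong (_xor parity x) n-even)

  -- In even dimension a shift preserves the parity, so both sides compose the same two shifts.
  twist-shift : ∀ b (x : Vertex n) → twist (shift b x) ≡ shift b (twist x)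
  twist-shift b x =
    trans (cong (λ c → shift c (shift b x)) (parity-shift b x)) (shift-comm (parity x) b x)

  twist-involutive : (x : Vertex n) → twist (twist x) ≡ x
  twist-involutive x =
    trans (twist-shift (parity x) x) (shift-involutive (parity x) x)

-- The parallelogram law for twisted labelings

-- `twist` sends two opposite corners of the face at x into the face at `twist x`, and the other two
-- into the antipodal face. Two face sums and four antipodal sums then determine the relation.
associative-magic⇒parallelogram :
  {f : Labeling n} → AssociativeMagicFaced f → Parallelogram (label f ∘ twist)
associative-magic⇒parallelogram {f = f} ((s , magic) , S , assoc) x i j i≢j = begin
  L y + L (twist (flipAt i (flipAt j x)))          ≡⟨ cong (λ z → L y + L z) (twist-flip-flip i j x) ⟩
  L y + L (flipAt i (flipAt j y))
    ≡⟨ cancel (L y) _ _ _ (L (shift true y)) _ _ _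
         (opposite-sum y) (opposite-sum (flipAt i y)) (opposite-sum (flipAt j y))
         (opposite-sum (flipAt i (flipAt j y))) (magic y i j i≢j) (opposite-face) ⟩
  L (shift true (flipAt i y)) + L (shift true (flipAt j y))
    ≡⟨ cong₂ (λ v w → L v + L w) (twist-flip i x) (twist-flip j x) ⟨
  L (twist (flipAt i x)) + L (twist (flipAt j x))  ∎
  where
  open ≡-Reasoning
  L = label f
  y = twist x
  opposite-sum : ∀ z → L z + L (shift true z) ≡ S
  opposite-sum z = assoc z (shift true z) (antipodal-shift z)
  opposite-face : L (shift true y) + L (shift true (flipAt i y)) + L (shift true (flipAt j y))
                  + L (shift true (flipAt i (flipAt j y))) ≡ s
  opposite-face = begin
    L (shift true y) + L (shift true (flipAt i y)) + L (shift true (flipAt j y))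
      + L (shift true (flipAt i (flipAt j y)))
      ≡⟨ cong₂ _+_ (cong₂ (λ v w → L (shift true y) + L v + L w) (shift-flip true i y) (shift-flip true j y))
           (cong L (trans (shift-flip true i (flipAt j y)) (cong (flipAt i) (shift-flip true j y)))) ⟩
    faceSum f (shift true y) i j
      ≡⟨ magic (shift true y) i j i≢j ⟩
    s ∎
  cancel : ∀ a b c d a′ b′ c′ d′ → a + a′ ≡ S → b + b′ ≡ S → c + c′ ≡ S → d + d′ ≡ S →
           a + b + c + d ≡ s → a′ + b′ + c′ + d′ ≡ s → a + d ≡ b′ + c′
  cancel a b c d a′ b′ c′ d′ aa bb cc dd abcd abcd′ =
    -- The number s + S + S is expanded in two ways: by the face at y with the pairs of a and d, and
    -- by the antipodal face with the pairs of b and c. The terms b + c + a′ + d′ are common to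
    -- both.
    ℕ.*-cancelˡ-≡ (a + d) (b′ + c′) 2 (ℕ.+-cancelʳ-≡ (b + c + a′ + d′) _ _ (begin
      2 * (a + d) + (b + c + a′ + d′)              ≡⟨ regroup₁ a b c d a′ d′ ⟩
      (a + b + c + d) + (a + a′) + (d + d′)        ≡⟨ cong₂ _+_ (cong₂ _+_ abcd aa) dd ⟩
      s + S + S                                    ≡⟨ cong₂ _+_ (cong₂ _+_ abcd′ bb) cc ⟨
      (a′ + b′ + c′ + d′) + (b + b′) + (c + c′)    ≡⟨ regroup₂ b c a′ b′ c′ d′ ⟩
      2 * (b′ + c′) + (b + c + a′ + d′)            ∎))
    where
    regroup₁ : ∀ a b c d a′ d′ →
      2 * (a + d) + (b + c + a′ + d′) ≡ (a + b + c + d) + (a + a′) + (d + d′)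
    regroup₁ = solve-∀
    regroup₂ : ∀ b c a′ b′ c′ d′ →
      (a′ + b′ + c′ + d′) + (b + b′) + (c + c′) ≡ 2 * (b′ + c′) + (b + c + a′ + d′)
    regroup₂ = solve-∀

-- Nonexistence in odd dimension

label-injective : (f : Labeling n) → ∀ {x y} → label f x ≡ label f y → x ≡ y
label-injective f = Bijection.injective f ∘ toℕ-injective ∘ ℕ.suc-injective

-- `F` takes the same value at the origin and at all unit vertices. For n at least 2 there are two
-- unit vertices, and injectivity of the labeling would make their twists equal, although these
-- differ in the flipped coordinate.
¬associative-magic-odd : ¬ (2 ∣ n) → n ≢ 1 → ¬ ∃ (AssociativeMagicFaced {n})
¬associative-magic-odd {zero} 2∤0 _ _ = 2∤0 (2 ∣0)
¬associative-magic-odd {suc zero} _ 1≢1 _ = 1≢1 refl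
¬associative-magic-odd {n@(suc (suc _))} 2∤n _ (f , amf) = contradiction
  (flip-index {i = zero} {suc zero} (twist origin) (shift-injective (begin
    shift true (flipAt zero (twist origin))        ≡⟨ twist-flip zero origin ⟨
    twist (unit zero)                              ≡⟨ label-injective f (trans (sym (F-unit zero)) (F-unit (suc zero))) ⟩
    twist (unit (suc zero))                        ≡⟨ twist-flip (suc zero) origin ⟩
    shift true (flipAt (suc zero) (twist origin))  ∎)))
  λ ()
  where
  open ≡-Reasoning
  F : Vertex n → ℕ
  F = label f ∘ twist
  n-odd = 2∤⇒odd≡true 2∤n
  shift-injective : {x y : Vertex n} → shift true x ≡ shift true y → x ≡ y
  shift-injective {x} {y} p = trans (sym (shift-involutive true x))
    (trans (cong (shift true) p) (shift-involutive true y))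
  F-complement : ∀ x → F (shift true x) ≡ F x
  F-complement x = cong (label f) (twist-complement-odd n-odd x)
  F-unit : ∀ i → F origin ≡ F (unit i)
  F-unit i = ℕ.*-cancelˡ-≡ (F origin) (F (unit i)) 2 (begin
    2 * F origin                                  ≡⟨ double (F origin) ⟩
    F origin + F origin                           ≡⟨ cong (_+ F origin) (F-complement origin) ⟨
    F (shift true origin) + F origin              ≡⟨ cong (λ x → F x + F origin) flip-x ⟨
    F (flipAt i x) + F origin                     ≡⟨ parallelogram⇒additive F (associative-magic⇒parallelogram {f = f} amf) i x xᵢ ⟩
    F x + F (unit i)                              ≡⟨ cong (_+ F (unit i)) (F-complement (unit i)) ⟩
    F (unit i) + F (unit i)                       ≡⟨ double (F (unit i)) ⟨
    2 * F (unit i)                                ∎)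
    where
    -- Coordinate i is false here, and flipping it gives the antipode of the origin. Antipodal
    -- invariance then turns additivity at x into 2 F(origin) = 2 F(unit i).
    x = shift true (unit i)
    double : ∀ m → 2 * m ≡ m + m
    double = solve-∀
    xᵢ : lookup x i ≡ false
    xᵢ = trans (lookup-map i not (unit i)) (cong not (lookup-unit i))
    flip-x : flipAt i x ≡ shift true origin
    flip-x = trans (sym (shift-flip true i (unit i))) (cong (shift true) (flip-involutive i origin))

-- The associative magic-faced hypercube of even dimension

module _ (n-even : odd n ≡ false) where

  twisted-binary : Labeling n
  twisted-binary = binary-⤖ ⤖-∘ ↔⇒⤖ (mk↔ₛ′ twist twist (twist-involutive n-even) (twist-involutive n-even))
    where
    binary-⤖ : Vertex n ⤖ Fin (2 ^ n)
    binary-⤖ = mk⤖ (binary-injective , strictlySurjective⇒surjective binary-surjective)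

  -- The parallelogram law replaces the two corners in the face at `twist x` by the other two
  -- corners of that face, whose antipodes are the remaining summands. Each antipodal pair of labels
  -- contributes 2 ^ n + 1.
  twisted-binary-magic : MagicFaced twisted-binary
  twisted-binary-magic = 2 ^ n + 2 ^ n + 2 , magic
    where
    open ≡-Reasoning
    regroup₁ : ∀ a b′ c′ d → suc a + suc b′ + suc c′ + suc d ≡ (a + d) + (b′ + c′) + 4
    regroup₁ = solve-∀
    regroup₂ : ∀ b c b′ c′ → (b + c) + (b′ + c′) + 4 ≡ suc (b + b′) + suc (c + c′) + 2
    regroup₂ = solve-∀
    magic : ∀ x i j → i ≢ j → faceSum twisted-binary x i j ≡ 2 ^ n + 2 ^ n + 2
    magic x i j i≢j = begin
      faceSum twisted-binary x i j
        ≡⟨ cong₂ _+_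
             (cong₂ (λ v w → suc (value y) + suc (value v) + suc (value w)) (twist-flip i x) (twist-flip j x))
             (cong (suc ∘ value) (twist-flip-flip i j x)) ⟩
      suc (value y) + suc b′ + suc c′ + suc d        ≡⟨ regroup₁ (value y) b′ c′ d ⟩
      (value y + d) + (b′ + c′) + 4                  ≡⟨ cong (λ k → k + (b′ + c′) + 4) (value-parallelogram y i j i≢j) ⟩
      (b + c) + (b′ + c′) + 4                        ≡⟨ regroup₂ b c b′ c′ ⟩
      suc (b + b′) + suc (c + c′) + 2
        ≡⟨ cong (_+ 2) (cong₂ _+_ (value-complement (flipAt i y)) (value-complement (flipAt j y))) ⟩
      2 ^ n + 2 ^ n + 2 ∎
      where
      y = twist x
      b = value (flipAt i y)
      c = value (flipAt j y)
      b′ = value (shift true (flipAt i y))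
      c′ = value (shift true (flipAt j y))
      d = value (flipAt i (flipAt j y))

  -- In even dimension `twist` commutes with the antipodal map, so antipodal vertices receive
  -- complementary binary expansions.
  twisted-binary-associative : Associative twisted-binary
  twisted-binary-associative = suc (2 ^ n) , assoc
    where
    open ≡-Reasoning
    assoc : ∀ x y → Antipodal x y →
            label twisted-binary x + label twisted-binary y ≡ suc (2 ^ n)
    assoc x y a = begin
      suc (value (twist x)) + suc (value (twist y))
        ≡⟨ cong (λ z → suc (value (twist x)) + suc (value z))
             (trans (cong twist (antipodal⇒shift x y a)) (twist-shift n-even true x)) ⟩
      suc (value (twist x)) + suc (value (shift true (twist x)))
        ≡⟨ ℕ.+-suc (suc (value (twist x))) _ ⟩
      suc (suc (value (twist x) + value (shift true (twist x))))
        ≡⟨ cong suc (value-complement (twist x)) ⟩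
      suc (2 ^ n) ∎

  -- Uniqueness in even dimension

  module Uniqueness {f : Labeling n} (amf : AssociativeMagicFaced f) where

    -- Labels are counted from 0 here, to match `value`.
    F : Vertex n → ℕ
    F x = toℕ (Bijection.to f (twist x))

    F-parallelogram : Parallelogram F
    F-parallelogram x i j i≢j = ℕ.suc-injective (ℕ.suc-injective
      (trans (cong suc (sym (ℕ.+-suc (F x) _)))
        (trans (associative-magic⇒parallelogram {f = f} amf x i j i≢j)
          (cong suc (ℕ.+-suc (F (flipAt i x)) _)))))

    F-injective : ∀ {x y} → F x ≡ F y → x ≡ y
    F-injective {x} {y} p = trans (sym (twist-involutive n-even x))
      (trans (cong twist (Bijection.injective f (toℕ-injective p))) (twist-involutive n-even y))

    F-surjective : ∀ m → m < 2 ^ n → ∃ λ x → F x ≡ m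
    F-surjective m m<2^n with x , p ← Bijection.strictlySurjective f (fromℕ< m<2^n) =
      twist x , trans (cong (toℕ ∘ Bijection.to f) (twist-involutive n-even x))
        (trans (cong toℕ p) (toℕ-fromℕ< m<2^n))

    minimum : ∃ λ x → F x ≡ 0
    minimum = F-surjective 0 (ℕ.m^n>0 2 n)

    -- This carries the origin to the vertex where `F` is 0, so that the translated function `G`
    -- vanishes at the origin.
    translation : Hyp.Carrier n
    translation = lookup (proj₁ minimum) , Perm.id

    translation⁻¹ : Hyp.Carrier n
    translation⁻¹ = Hyp._⁻¹ n translation

    G : Vertex n → ℕ
    G = F ∘ act translation

    G-origin : G origin ≡ 0
    G-origin = trans (cong F (vertex-ext (act-origin translation))) (proj₂ minimum)

    G-parallelogram : Parallelogram G
    G-parallelogram x i j i≢j = begin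
      F (τ x) + F (τ (flipAt i (flipAt j x)))
        ≡⟨ cong (λ y → F (τ x) + F y)
             (trans (act-flip translation i (flipAt j x)) (cong (flipAt i) (act-flip translation j x))) ⟩
      F (τ x) + F (flipAt i (flipAt j (τ x)))
        ≡⟨ F-parallelogram (τ x) i j i≢j ⟩
      F (flipAt i (τ x)) + F (flipAt j (τ x))
        ≡⟨ cong₂ (λ y z → F y + F z) (act-flip translation i x) (act-flip translation j x) ⟨
      F (τ (flipAt i x)) + F (τ (flipAt j x)) ∎
      where
      open ≡-Reasoning
      τ = act translation

    G-additiveBijection : AdditiveBijection G
    G-additiveBijection = record
      { F-origin   = G-origin
      ; additive   = λ i x xᵢ → begin
          G (flipAt i x)              ≡⟨ ℕ.+-identityʳ _ ⟨
          G (flipAt i x) + 0          ≡⟨ cong (G (flipAt i x) +_) G-origin ⟨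
          G (flipAt i x) + G origin   ≡⟨ parallelogram⇒additive G G-parallelogram i x xᵢ ⟩
          G x + G (unit i)            ∎
      ; injective  = λ {x} {y} p → trans (sym (act-inverseˡ translation x))
          (trans (cong (act translation⁻¹) (F-injective p)) (act-inverseˡ translation y))
      ; surjective = λ m m<2^n → let x , p = F-surjective m m<2^n in
          act translation⁻¹ x , trans (cong F (act-inverseʳ translation x)) p
      ; bounded    = λ x → toℕ<n _
      }
      where open ≡-Reasoning

    π : Hyp.Carrier n
    π = (λ _ → false) , Weights.coordinates G-additiveBijection

    h : Hyp.Carrier n
    h = Hyp._∙_ n π translation⁻¹

    F≡value-act : ∀ x → F x ≡ value (act h x)
    F≡value-act x = begin
      F x                                      ≡⟨ cong F (act-inverseʳ translation x) ⟨
      G (act translation⁻¹ x)                  ≡⟨ Weights.F≡value G-additiveBijection (act translation⁻¹ x) ⟩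
      value (act π (act translation⁻¹ x))      ≡⟨ cong value (act-∙ π translation⁻¹ x) ⟨
      value (act h x)                          ∎
      where open ≡-Reasoning

    q : Bool
    q = parity (act h origin)

    h′ : Hyp.Carrier n
    h′ = Hyp._∙_ n ((λ _ → q) , Perm.id) h

    -- The parities of `act h x` and x differ by the constant `q`. The shift by `q` built into `h′`
    -- compensates for this difference.
    twist-act : ∀ x → twist (act h′ x) ≡ act h (twist x)
    twist-act x = begin
      twist (act h′ x)                         ≡⟨ cong twist (act-∙ ((λ _ → q) , Perm.id) h x) ⟩
      twist (act ((λ _ → q) , Perm.id) y)      ≡⟨ cong twist (shift≡act q y) ⟨
      twist (shift q y)                        ≡⟨ twist-shift n-even q y ⟩
      shift q (shift (parity y) y)             ≡⟨ shift-shift q (parity y) y ⟩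
      shift (q xor parity y) y                 ≡⟨ cong (λ b → shift (q xor b) y) (parity-act h x) ⟩
      shift (q xor (q xor parity x)) y         ≡⟨ cong (λ b → shift b y) (xor-cancelˡ q (parity x)) ⟩
      shift (parity x) y                       ≡⟨ act-shift h (parity x) x ⟨
      act h (twist x)                          ∎
      where
      open ≡-Reasoning
      y = act h x

    twisted-binary∼ : twisted-binary ∼ f
    twisted-binary∼ = fromHyp h′ , λ x → cong suc (begin
      toℕ (Bijection.to f x)       ≡⟨ cong (toℕ ∘ Bijection.to f) (twist-involutive n-even x) ⟨
      F (twist x)                  ≡⟨ F≡value-act (twist x) ⟩
      value (act h (twist x))      ≡⟨ cong value (twist-act x) ⟨
      value (twist (act h′ x))     ∎)
      where open ≡-Reasoning

theorem6 : (n : ℕ) →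
    (2 ∣ n → ∃! _∼_ (AssociativeMagicFaced {n}))
    × (¬ (2 ∣ n) → n ≢ 1 → ¬ ∃ (AssociativeMagicFaced {n}))
    × (Aut n ≅ HyperoctahedralGroup n)
theorem6 n =
  (λ 2∣n → let n-even = 2∣⇒odd≡false 2∣n in
    twisted-binary n-even ,
    (twisted-binary-magic n-even , twisted-binary-associative n-even) ,
    λ {f} amf → Uniqueness.twisted-binary∼ n-even {f} amf) ,
  ¬associative-magic-odd ,
  Aut≅HyperoctahedralGroup n
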